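{- For every bipartite graph $G$ of maximum degree $d$ with vertex bipartition $(U,V)$ such that $|U|>|V|$, there is a Circular Resolution refutation of $G\text{ - }\mathrm{PHP}$ of length polynomial in $|U|+|V|$ and width $d$.
   Context: Graph pigeonhole principle. For a (finite) bipartite graph $G$ with bipartition $(U,V)$ and edge set $E\subseteq U\times V$, let $N_G(w)$ be the set of neighbours of $w$. The CNF formula $G\text{ - }\mathrm{PHP}$ has one variable $X_{u,v}$ for each edge $(u,v)\in E$ and the clauses: $X_{u,v_1}\vee\cdots\vee X_{u,v_r}$ for each $u\in U$ with $N_G(u)=\{v_1,\dots,v_r\}$; and $\overline{X_{u_1,v}}\vee\overline{X_{u_2,v}}$ for all $u_1\neq u_2$ in $U$ and $v\in N_G(u_1)\cap N_G(u_2)$. Circular Resolution. A literal is a propositional variable $X$ or its negation $\overline{X}$. A clause is a finite set of literals read as a disjunction; $0$ denotes the empty clause. The rules are, for clauses $C$ and variables $X$: axiom (no premises, conclusion $X\vee\overline{X}$); symmetric cut (premises $C\vee X$ and $C\vee\overline{X}$, conclusion $C$); split (premise $C$, two conclusions $C\vee X$ and $C\vee\overline{X}$). A circular pre-proof $\Pi$ is a finite directed bipartite graph with formula-vertices (set $J$), each labelled by a clause, and inference-vertices (set $I$), each labelled by an instance of a rule whose premises are the labels of its in-neighbours and whose conclusions are the labels of its out-neighbours; cycles are allowed. A flow assignment is a map $F:I\to\mathbb{R}^+$ to the positive reals; the balance of $u\in J$ is $B(u)=\sum_{w\in N^-(u)}F(w)-\sum_{w\in N^+(u)}F(w)$, where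 $N^-(u),N^+(u)$ are the sets of in- and out-neighbours of $u$. Sources are the formula-vertices of strictly negative balance, sinks those of strictly positive balance. $\Pi$ is a Circular Resolution proof of a clause $A$ from a set of clauses $\mathscr{H}$ if there is a flow assignment for which every source is labelled by a clause in $\mathscr{H}$ and some sink is labelled by $A$. A refutation of $\mathscr{H}$ is a proof of the empty clause $0$ from $\mathscr{H}$; a refutation of a CNF formula is a refutation of its set of clauses. The length of the proof is its number of vertices and its width is the maximum number of literals in a clause labelling a formula-vertex.
   Formalization: The maximum degree d is assumed to be at least 1; for d = 0 the claim fails, since G-PHP then has no variables, so a proof has no inferences (any inference would need width at least 1) and no sink labelled by the empty clause. -}

module Defs where

open import Data.Bool using (Bool; T)
open import Data.Bool.Properties using (T?)
open import Data.Fin using (Fin)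
import Data.Fin.Properties as Fin
open import Data.List using (List; []; _∷_; _++_; allFin; deduplicate; filter; foldr; length; map; mapMaybe)
open import Data.List.Extrema.Nat using (max)
open import Data.List.Membership.Propositional using (_∈_)
open import Data.List.Relation.Binary.BagAndSetEquality using (_∼[_]_; set)
open import Data.List.Relation.Binary.Pointwise using (Pointwise)
open import Data.List.Relation.Unary.Any using (any?)
open import Data.List.Relation.Unary.Unique.Propositional using (Unique)
import Data.Maybe as Maybe
open Maybe using (Maybe)
open import Data.Nat using (ℕ; _⊔_)
import Data.Nat as ℕ
import Data.Nat.Properties as ℕ
open import Data.Product using (∃-syntax; _×_; _,_)
open import Data.Rational using (ℚ; 0ℚ; ½; _+_; _*_; -_; _-_; ∣_∣; _<_; _≤_)
import Data.Rational.Properties as ℚ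
open import Data.Rational.Solver using (module +-*-Solver)
open import Relation.Binary using (DecidableEquality)
open import Relation.Binary.PropositionalEquality using (_≡_; _≢_; refl; cong; subst)
open import Relation.Nullary using (yes; no)
open import Relation.Nullary.Decidable using (dec⇒maybe; map′)

------------------------------------------------------------------------
-- Real numbers, as Cauchy sequences of rationals

record ℝ : Set where
  field
    seq    : ℕ → ℚ
    cauchy : ∀ {ε} → 0ℚ < ε →
             ∃[ N ] (∀ {i j} → N ℕ.≤ i → N ℕ.≤ j → ∣ seq i - seq j ∣ < ε)

open ℝ public

-- The rational gap ε makes the order respect equality of limits.
infix 4 _<ℝ_
_<ℝ_ : ℝ → ℝ → Set
x <ℝ y = ∃[ ε ] 0ℚ < ε × ∃[ N ] (∀ {i} → N ℕ.≤ i → seq x i + ε ≤ seq y i)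

0ℝ : ℝ
0ℝ .seq _ = 0ℚ
0ℝ .cauchy 0<ε = 0 , λ _ _ → 0<ε

private
  half : ∀ {ε} → 0ℚ < ε → 0ℚ < ½ * ε
  half {ε} 0<ε = subst (_< ½ * ε) (ℚ.*-zeroʳ ½) (ℚ.*-monoʳ-<-pos ½ 0<ε)

  halves : ∀ ε → ½ * ε + ½ * ε ≡ ε
  halves ε = begin-equality
    ½ * ε + ½ * ε ≡⟨ ℚ.*-distribʳ-+ ε ½ ½ ⟨
    (½ + ½) * ε   ≡⟨ ℚ.*-identityˡ ε ⟩
    ε             ∎
    where open ℚ.≤-Reasoning

  +-interchange : ∀ a b c d → (a + b) - (c + d) ≡ (a - c) + (b - d)
  +-interchange = solve 4 (λ a b c d →
    (a :+ b) :- (c :+ d) := (a :- c) :+ (b :- d)) refl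
    where open +-*-Solver

  neg-interchange : ∀ a b → - a - - b ≡ - (a - b)
  neg-interchange = solve 2 (λ a b → (:- a) :- (:- b) := :- (a :- b)) refl
    where open +-*-Solver

infixl 6 _+ℝ_ _-ℝ_
infix  8 -ℝ_

_+ℝ_ : ℝ → ℝ → ℝ
(x +ℝ y) .seq i = seq x i + seq y i
(x +ℝ y) .cauchy {ε} 0<ε =
  let M , p = cauchy x (half 0<ε)
      N , q = cauchy y (half 0<ε)
  in M ⊔ N , λ {i} {j} i≥ j≥ → begin-strict
    ∣ (seq x i + seq y i) - (seq x j + seq y j) ∣
      ≡⟨ cong ∣_∣ (+-interchange (seq x i) (seq y i) (seq x j) (seq y j)) ⟩
    ∣ (seq x i - seq x j) + (seq y i - seq y j) ∣
      ≤⟨ ℚ.∣p+q∣≤∣p∣+∣q∣ (seq x i - seq x j) (seq y i - seq y j) ⟩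
    ∣ seq x i - seq x j ∣ + ∣ seq y i - seq y j ∣
      <⟨ ℚ.+-mono-< (p (ℕ.m⊔n≤o⇒m≤o M N i≥) (ℕ.m⊔n≤o⇒m≤o M N j≥))
                    (q (ℕ.m⊔n≤o⇒n≤o M N i≥) (ℕ.m⊔n≤o⇒n≤o M N j≥)) ⟩
    ½ * ε + ½ * ε
      ≡⟨ halves ε ⟩
    ε ∎
  where open ℚ.≤-Reasoning

-ℝ_ : ℝ → ℝ
(-ℝ x) .seq i = - seq x i
(-ℝ x) .cauchy {ε} 0<ε =
  let N , p = cauchy x 0<ε
  in N , λ {i} {j} i≥ j≥ → begin-strict
    ∣ - seq x i - - seq x j ∣  ≡⟨ cong ∣_∣ (neg-interchange (seq x i) (seq x j)) ⟩
    ∣ - (seq x i - seq x j) ∣  ≡⟨ ℚ.∣-p∣≡∣p∣ (seq x i - seq x j) ⟩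
    ∣ seq x i - seq x j ∣      <⟨ p i≥ j≥ ⟩
    ε                          ∎
  where open ℚ.≤-Reasoning

_-ℝ_ : ℝ → ℝ → ℝ
x -ℝ y = x +ℝ (-ℝ y)

sumℝ : List ℝ → ℝ
sumℝ = foldr _+ℝ_ 0ℝ

------------------------------------------------------------------------
-- Circular Resolution

data Literal (X : Set) : Set where
  pos neg : X → Literal X

-- A clause is a finite set of literals: a list, taken up to _≋_.
Clause : Set → Set
Clause X = List (Literal X)

infix 4 _≋_
_≋_ : ∀ {X} → Clause X → Clause X → Set
C ≋ D = C ∼[ set ] D

module CircularResolution {X : Set} (_≟_ : DecidableEquality X) where

  _≟ˡ_ : DecidableEquality (Literal X)
  pos x ≟ˡ pos y = map′ (cong pos) (λ { refl → refl }) (x ≟ y)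
  neg x ≟ˡ neg y = map′ (cong neg) (λ { refl → refl }) (x ≟ y)
  pos x ≟ˡ neg y = no λ ()
  neg x ≟ˡ pos y = no λ ()

  ∣_∣ᶜ : Clause X → ℕ
  ∣ C ∣ᶜ = length (deduplicate _≟ˡ_ C)

  data Rule : Set where
    axiom     : X → Rule
    cut split : Clause X → X → Rule

  premises : Rule → List (Clause X)
  premises (axiom x)   = []
  premises (cut C x)   = (pos x ∷ C) ∷ (neg x ∷ C) ∷ []
  premises (split C x) = C ∷ []

  conclusions : Rule → List (Clause X)
  conclusions (axiom x)   = (pos x ∷ neg x ∷ []) ∷ []
  conclusions (cut C x)   = C ∷ []
  conclusions (split C x) = (pos x ∷ C) ∷ (neg x ∷ C) ∷ []

  -- The neighbours of an inference-vertex are matched one-to-one with the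
  -- premises and conclusions of its rule.  Equating only the sets of labels
  -- would let a conclusion be duplicated, which is unsound.
  record PreProof : Set where
    field
      #J #I : ℕ
      label : Fin #J → Clause X
      rule  : Fin #I → Rule
      ins outs    : Fin #I → List (Fin #J)
      ins-unique  : ∀ w → Unique (ins w)
      outs-unique : ∀ w → Unique (outs w)
      ins-label   : ∀ w → Pointwise (λ u C → label u ≋ C) (ins w) (premises (rule w))
      outs-label  : ∀ w → Pointwise (λ u C → label u ≋ C) (outs w) (conclusions (rule w))

    N⁻ N⁺ : Fin #J → List (Fin #I)
    N⁻ u = filter (λ w → any? (u Fin.≟_) (outs w)) (allFin #I)
    N⁺ u = filter (λ w → any? (u Fin.≟_) (ins w)) (allFin #I)

    balance : (Fin #I → ℝ) → Fin #J → ℝ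
    balance F u = sumℝ (map F (N⁻ u)) -ℝ sumℝ (map F (N⁺ u))

    size : ℕ
    size = #J ℕ.+ #I

    width : ℕ
    width = max 0 (map (λ u → ∣ label u ∣ᶜ) (allFin #J))

  open PreProof public

  record IsProof (H : Clause X → Set) (A : Clause X) (Π : PreProof) : Set where
    field
      flow     : Fin (#I Π) → ℝ
      positive : ∀ w → 0ℝ <ℝ flow w
      sources  : ∀ u → balance Π flow u <ℝ 0ℝ → ∃[ C ] H C × label Π u ≋ C
      sink     : ∃[ u ] 0ℝ <ℝ balance Π flow u × label Π u ≋ A

  IsRefutation : (Clause X → Set) → PreProof → Set
  IsRefutation H = IsProof H []

------------------------------------------------------------------------
-- The graph pigeonhole principle

-- Finite bipartite graphs with parts U = Fin m and V = Fin n
BipartiteGraph : ℕ → ℕ → Set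
BipartiteGraph m n = Fin m → Fin n → Bool

module _ {m n : ℕ} (G : BipartiteGraph m n) where

  record Edge : Set where
    constructor edge
    field
      left    : Fin m
      right   : Fin n
      .isEdge : T (G left right)

  open Edge

  edge? : Fin m → Fin n → Maybe Edge
  edge? u v = Maybe.map (λ e → edge u v e) (dec⇒maybe (T? (G u v)))

  incidentˡ : Fin m → List Edge
  incidentˡ u = mapMaybe (λ v → edge? u v) (allFin n)

  incidentʳ : Fin n → List Edge
  incidentʳ v = mapMaybe (λ u → edge? u v) (allFin m)

  maxDegree : ℕ
  maxDegree = max 0 (map (λ u → length (incidentˡ u)) (allFin m) ++
                     map (λ v → length (incidentʳ v)) (allFin n))

  _≟ᵉ_ : DecidableEquality Edge
  edge u v _ ≟ᵉ edge u′ v′ _ with u Fin.≟ u′ | v Fin.≟ v′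
  ... | yes refl | yes refl = yes refl
  ... | no u≢u′  | _        = no λ { refl → u≢u′ refl }
  ... | yes _    | no v≢v′  = no λ { refl → v≢v′ refl }

  data PHP : Clause Edge → Set where
    pigeon : ∀ u → PHP (map pos (incidentˡ u))
    hole   : ∀ e₁ e₂ → left e₁ ≢ left e₂ → right e₁ ≡ right e₂ →
             PHP (neg e₁ ∷ neg e₂ ∷ [])

{-# OPTIONS --safe #-}
module Submission where

-- All flows are 1, so only numbers of inferences matter.  A pigeon clause and the
-- unit clauses ¬X_e, for the edges e at the pigeon, yield the empty clause: cut
-- after weakening.  Conversely, from one empty clause and the hole clauses at v
-- one obtains ¬X_e for every edge e at v: split on the edges one by one and cut away
-- the positive literals.  Every edge occurs once on either side, so n empty clauses
-- are turned into m > n of them, and the empty clause has positive balance.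

open import Defs
open import Data.Bool.Properties using (T?)
open import Data.Empty using (⊥; ⊥-elim)
open import Data.Fin using (Fin; zero; suc)
open import Data.Fin.Patterns
import Data.Fin.Properties as Fin
open import Data.List
  using (List; []; _∷_; _++_; allFin; concatMap; deduplicate; filter; length; lookup; map; mapMaybe)
import Data.List.Properties as List
open import Data.List.Extrema.Nat using (argmax-sel; max; max≤v⁺; v≤max⁺; xs≤max)
open import Data.List.Membership.Propositional using (_∈_; _∉_)
open import Data.List.Membership.Propositional.Properties
  using (∈-++⁺ˡ; ∈-++⁺ʳ; ∈-++⁻; ∈-allFin; ∈-concatMap⁺; ∈-lookup; ∈-map⁺; ∈-map⁻)
open import Data.List.Relation.Binary.BagAndSetEquality using ([_]-Equality; bag-=⇒; set; ↭⇒∼bag)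
open import Data.List.Relation.Binary.Permutation.Propositional using (_↭_; swap; ↭-refl)
open import Data.List.Relation.Binary.Permutation.Propositional.Properties using (++-comm)
open import Data.List.Relation.Binary.Pointwise using (Pointwise; []; _∷_)
open import Data.List.Relation.Binary.Subset.Propositional using (_⊆_)
open import Data.List.Relation.Unary.All as All using (All; []; _∷_)
import Data.List.Relation.Unary.All.Properties as All
open import Data.List.Relation.Unary.AllPairs as AllPairs using (AllPairs; []; _∷_)
import Data.List.Relation.Unary.AllPairs.Properties as AllPairs
open import Data.List.Relation.Unary.Any as Any using (Any; any?; here; there)
import Data.List.Relation.Unary.Any.Properties as Any
open import Data.List.Relation.Unary.Unique.DecSetoid.Properties using (deduplicate-!)
open import Data.List.Relation.Unary.Unique.Propositional using (Unique)
import Data.List.Relation.Unary.Unique.Propositional.Properties as Unique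
open import Data.Maybe using (Maybe; just; nothing; maybe′)
open import Data.Nat using (ℕ; zero; suc; _+_; _*_; _^_; _≤_; _<_; z≤n; s≤s)
open import Data.Nat.ListAction using (sum)
open import Data.Nat.ListAction.Properties using (sum-++)
import Data.Nat.Properties as ℕ
open import Data.Nat.Solver using (module +-*-Solver)
open import Data.Product using (∃-syntax; _×_; _,_; proj₁; proj₂)
open import Data.Rational as ℚ using (ℚ; 0ℚ; 1ℚ)
import Data.Rational.Properties as ℚ
import Data.Rational.Solver as ℚ
open import Data.Sum using (_⊎_; inj₁; inj₂)
open import Data.Unit using (tt)
open import Function using (Equivalence; _∘_; id; mk⇔)
open import Relation.Binary using (DecSetoid; DecidableEquality; Setoid)
open import Relation.Binary.PropositionalEquality
  using (_≡_; _≢_; refl; sym; trans; cong; cong₂; subst; subst₂; module ≡-Reasoning)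
open import Relation.Nullary using (Dec; yes; no; ¬_; ¬?; _×-dec_; contradiction)
open import Relation.Nullary.Decidable using (map′)
open import Relation.Unary using (Decidable; Pred)

-- Any vertex may end with positive balance, so surplus clauses can be abandoned: the negative
-- branches of weakening, and at each hole the disjunction of all its positive literals, whose size
-- is the degree of the hole. Hypotheses may be sources, so hole clauses can be used any number of
-- times; only the empty clauses and the clauses ¬X_e have to be counted. Hence a `Net` asserts an
-- inequality, and it does so against every weight that respects `≋`: bags are compared by weights
-- alone, and the weight that is 1 on one class of clauses and 0 elsewhere later yields the balance
-- at the vertex of that class. In the pre-proof built from a net, equal clauses share a vertex,
-- which is what closes the cycles; the price is that no inference may have two premises or two
-- conclusions that agree as sets. Width exactly d is reached by adding a clause with d literals to
-- the labels.

private variable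
  Y Z : Set

∑ : List Y → (Y → ℕ) → ℕ
∑ xs f = sum (map f xs)

∑-++ : ∀ (xs ys : List Y) f → ∑ (xs ++ ys) f ≡ ∑ xs f + ∑ ys f
∑-++ xs ys f = trans (cong sum (List.map-++ f xs ys)) (sum-++ (map f xs) (map f ys))

↭⇒≋ : ∀ {X} {C D : Clause X} → C ↭ D → C ≋ D
↭⇒≋ p = bag-=⇒ (↭⇒∼bag p)

-- Multisets of clauses transformed by inferences

module Nets {X : Set} (_≟_ : DecidableEquality X) (H : Clause X → Set) (d : ℕ) where

  open CircularResolution _≟_

  -- The sets `pos x ∷ C` and `neg x ∷ C` coincide exactly when `C` contains both literals of `x`;
  -- an inference would then meet one vertex twice. The strict bound on `C` leaves room for the
  -- literal of `x` within `d`.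
  data Proper : Rule → Set where
    cut   : ∀ {C x} → length C < d → ¬ (pos x ∈ C × neg x ∈ C) → Proper (cut C x)
    split : ∀ {C x} → length C < d → ¬ (pos x ∈ C × neg x ∈ C) → Proper (split C x)

  Weight : Set
  Weight = Clause X → ℕ

  Invariant : Weight → Set
  Invariant δ = ∀ {C D} → C ≋ D → δ C ≡ δ D

  -- A multiset of clauses, given by its total weight.
  Bag : Set
  Bag = Weight → ℕ

  ∅ : Bag
  ∅ δ = 0

  ⟪_⟫ : Clause X → Bag
  ⟪ C ⟫ δ = δ C

  infixr 6 _⊕_
  _⊕_ : Bag → Bag → Bag
  (A ⊕ B) δ = A δ + B δ

  ⨁ : List Y → (Y → Bag) → Bag
  ⨁ ys A δ = ∑ ys (λ y → A y δ)

  -- Inferences turning A into B, up to leftovers, with every flow equal to 1.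
  record Net (A B : Bag) (k : ℕ) : Set where
    field
      rules    : List Rule
      hyps     : List (Clause X)
      proper   : All Proper rules
      hyps∈H   : All H hyps
      short    : length rules ≤ k
      conserve : ∀ {δ} → Invariant δ →
                 B δ + ∑ rules (λ r → ∑ (premises r) δ) ≤
                 A δ + (∑ hyps δ + ∑ rules (λ r → ∑ (conclusions r) δ))

  open Net public

  private variable
    A A′ B B′ C′ : Bag
    k l : ℕ
    C D : Clause X

  relax : k ≤ l → Net A B k → Net A B l
  relax k≤l N = record
    { rules = rules N ; hyps = hyps N ; proper = proper N ; hyps∈H = hyps∈H N
    ; short = ℕ.≤-trans (short N) k≤l ; conserve = conserve N }

  none : (∀ {δ} → Invariant δ → B δ ≤ A δ) → Net A B 0
  none B≤A = record
    { rules = [] ; hyps = [] ; proper = [] ; hyps∈H = [] ; short = z≤n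
    ; conserve = λ inv → ℕ.+-monoˡ-≤ 0 (B≤A inv) }

  shuffle : (∀ δ → B δ ≡ A δ) → Net A B 0
  shuffle B≡A = none λ {δ} _ → ℕ.≤-reflexive (B≡A δ)

  idle : Net A A 0
  idle = shuffle λ _ → refl

  relabel : C ↭ D → Net ⟪ C ⟫ ⟪ D ⟫ 0
  relabel p = none λ inv → ℕ.≤-reflexive (sym (inv (↭⇒≋ p)))

  assume : H C → Net ∅ ⟪ C ⟫ 0
  assume {C} h = record
    { rules = [] ; hyps = C ∷ [] ; proper = [] ; hyps∈H = h ∷ [] ; short = z≤n
    ; conserve = λ {δ} _ → ℕ.≤-reflexive (sym (ℕ.+-identityʳ (δ C + 0))) }

  fromRule : ∀ r → Proper r → Net (⨁ (premises r) ⟪_⟫) (⨁ (conclusions r) ⟪_⟫) 1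
  fromRule r g = record
    { rules = r ∷ [] ; hyps = [] ; proper = g ∷ [] ; hyps∈H = [] ; short = s≤s z≤n
    ; conserve = λ {δ} _ → ℕ.≤-reflexive
        (solve 2 (λ p c → c :+ (p :+ con 0) := p :+ (c :+ con 0)) refl
          (∑ (premises r) δ) (∑ (conclusions r) δ)) }
    where open +-*-Solver

  private
    length-++-≤ : ∀ (rs ss : List Rule) → length rs ≤ k → length ss ≤ l →
                  length (rs ++ ss) ≤ k + l
    length-++-≤ rs ss p q rewrite List.length-++ rs {ss} = ℕ.+-mono-≤ p q

  infixl 5 _⨾_
  -- Adding the two conservation laws puts the weight of `B` on both sides, where it cancels.
  _⨾_ : Net A B k → Net B C′ l → Net A C′ (k + l)
  _⨾_ {A} {B} {C′ = C} M N = record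
    { rules    = rules M ++ rules N
    ; hyps     = hyps M ++ hyps N
    ; proper   = All.++⁺ (proper M) (proper N)
    ; hyps∈H   = All.++⁺ (hyps∈H M) (hyps∈H N)
    ; short    = length-++-≤ (rules M) (rules N) (short M) (short N)
    ; conserve = conserve′ }
    where
    open +-*-Solver
    open ℕ.≤-Reasoning
    conserve′ : ∀ {δ} → Invariant δ →
                C δ + ∑ (rules M ++ rules N) (λ r → ∑ (premises r) δ) ≤
                A δ + (∑ (hyps M ++ hyps N) δ +
                       ∑ (rules M ++ rules N) (λ r → ∑ (conclusions r) δ))
    conserve′ {δ} inv
      rewrite ∑-++ (rules M) (rules N) (λ r → ∑ (premises r) δ)
            | ∑-++ (rules M) (rules N) (λ r → ∑ (conclusions r) δ)
            | ∑-++ (hyps M) (hyps N) δ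
      = ℕ.+-cancelˡ-≤ (B δ) _ _ (begin
      B δ + (C δ + (pᴹ + pᴺ))
        ≡⟨ solve 4 (λ b c p q → b :+ (c :+ (p :+ q)) := (b :+ p) :+ (c :+ q)) refl
             (B δ) (C δ) pᴹ pᴺ ⟩
      (B δ + pᴹ) + (C δ + pᴺ)
        ≤⟨ ℕ.+-mono-≤ (conserve M inv) (conserve N inv) ⟩
      (A δ + (hᴹ + cᴹ)) + (B δ + (hᴺ + cᴺ))
        ≡⟨ solve 6 (λ a b h c i e → (a :+ (h :+ c)) :+ (b :+ (i :+ e))
                                  := b :+ (a :+ ((h :+ i) :+ (c :+ e)))) refl
             (A δ) (B δ) hᴹ cᴹ hᴺ cᴺ ⟩
      B δ + (A δ + ((hᴹ + hᴺ) + (cᴹ + cᴺ))) ∎)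
      where
      pᴹ = ∑ (rules M) (λ r → ∑ (premises r) δ)
      pᴺ = ∑ (rules N) (λ r → ∑ (premises r) δ)
      hᴹ = ∑ (hyps M) δ
      hᴺ = ∑ (hyps N) δ
      cᴹ = ∑ (rules M) (λ r → ∑ (conclusions r) δ)
      cᴺ = ∑ (rules N) (λ r → ∑ (conclusions r) δ)

  frame : Net A B k → Net (A ⊕ A′) (B ⊕ A′) k
  frame {A} {B} {A′ = R} N = record
    { rules = rules N ; hyps = hyps N ; proper = proper N ; hyps∈H = hyps∈H N ; short = short N
    ; conserve = λ {δ} inv → begin
        (B δ + R δ) + _ ≡⟨ swap₂₃ (B δ) (R δ) _ ⟩
        (B δ + _) + R δ ≤⟨ ℕ.+-monoˡ-≤ (R δ) (conserve N inv) ⟩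
        (A δ + _) + R δ ≡⟨ swap₂₃ (A δ) _ (R δ) ⟩
        (A δ + R δ) + _ ∎ }
    where
    open ℕ.≤-Reasoning
    open +-*-Solver
    swap₂₃ : ∀ a b c → (a + b) + c ≡ (a + c) + b
    swap₂₃ = solve 3 (λ a b c → (a :+ b) :+ c := (a :+ c) :+ b) refl

  infixl 5 _▹_
  _▹_ : Net A B k → Net B C′ 0 → Net A C′ k
  _▹_ {k = k} M N = relax (ℕ.≤-reflexive (ℕ.+-identityʳ k)) (M ⨾ N)

  ⊕-comm : ∀ A B → Net (A ⊕ B) (B ⊕ A) 0
  ⊕-comm A B = shuffle λ δ → ℕ.+-comm (B δ) (A δ)

  infixr 6 _∥_
  _∥_ : Net A B k → Net A′ B′ l → Net (A ⊕ A′) (B ⊕ B′) (k + l)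
  _∥_ {A = A} {B} {A′ = A′} {B′} M N =
    frame M ⨾ (⊕-comm B A′ ⨾ frame N ▹ ⊕-comm B′ B)

  parallel : ∀ {A B : Y → Bag} ys → (∀ y → Net (A y) (B y) k) →
             Net (⨁ ys A) (⨁ ys B) (length ys * k)
  parallel []       N = idle
  parallel (y ∷ ys) N = N y ∥ parallel ys N

  -- Nets for single rules, pigeons and holes

  cutNet : ∀ {C x} → Proper (cut C x) → Net (⟪ pos x ∷ C ⟫ ⊕ ⟪ neg x ∷ C ⟫) ⟪ C ⟫ 1
  cutNet {C} {x} g =
    shuffle (λ δ → cong (δ (pos x ∷ C) +_) (ℕ.+-identityʳ (δ (neg x ∷ C)))) ⨾ fromRule _ g ▹
    shuffle (λ δ → sym (ℕ.+-identityʳ (δ C)))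

  splitNet : ∀ {C x} → Proper (split C x) → Net ⟪ C ⟫ (⟪ pos x ∷ C ⟫ ⊕ ⟪ neg x ∷ C ⟫) 1
  splitNet {C} {x} g =
    shuffle (λ δ → ℕ.+-identityʳ (δ C)) ⨾ fromRule _ g ▹
    shuffle (λ δ → cong (δ (pos x ∷ C) +_) (sym (ℕ.+-identityʳ (δ (neg x ∷ C)))))

  neg∉map-pos : ∀ {x : X} xs → neg x ∉ map pos xs
  neg∉map-pos xs i with ∈-map⁻ pos i
  ... | _ , _ , ()

  -- Each split keeps its positive branch and leaves the negative one as surplus. Since `neg x`
  -- never occurs in the clause being split, the split is proper.
  weaken : ∀ xs C → All (λ x → neg x ∉ C) xs → length xs + length C ≤ d →
           Net ⟪ C ⟫ ⟪ map pos xs ++ C ⟫ (length xs)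
  weaken []       C []           _ = idle
  weaken (x ∷ xs) C (x∉C ∷ xs∉C) w = relax (ℕ.≤-reflexive (ℕ.+-comm (length xs) 1))
    (weaken xs C xs∉C (ℕ.<⇒≤ w) ⨾
     (splitNet (split (subst (_< d) (sym length-weakened) w) (fresh ∘ proj₂)) ▹
      none (λ {δ} _ → ℕ.m≤m+n (δ (pos x ∷ map pos xs ++ C)) (δ (neg x ∷ map pos xs ++ C)))))
    where
    length-weakened : length (map pos xs ++ C) ≡ length xs + length C
    length-weakened = trans (List.length-++ (map pos xs))
      (cong (_+ length C) (List.length-map pos xs))

    fresh : neg x ∉ map pos xs ++ C
    fresh i with ∈-++⁻ (map pos xs) i
    ... | inj₁ j = neg∉map-pos xs j
    ... | inj₂ j = x∉C j

  private
    -- Removing one literal when `t` others remain costs `t` splits, to weaken the clause to be cut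
    -- with, and one cut; the squares differ by `2t + 1`.
    square-step : ∀ t → (t + 1) + t * t ≤ suc t * suc t
    square-step t = begin
      (t + 1) + t * t       ≤⟨ ℕ.m≤m+n _ t ⟩
      ((t + 1) + t * t) + t ≡⟨ solve 1 (λ t → ((t :+ con 1) :+ t :* t) :+ t
                                := (con 1 :+ t) :* (con 1 :+ t)) refl t ⟩
      suc t * suc t         ∎
      where
      open ℕ.≤-Reasoning
      open +-*-Solver

    map-pos-length : ∀ (xs : List X) → length xs < d → length (map pos xs) < d
    map-pos-length xs = subst (_< d) (sym (List.length-map pos xs))

    neg∉neg : ∀ {x y : X} → x ≢ y → neg y ∉ neg x ∷ []
    neg∉neg x≢y (here refl) = x≢y refl

  -- The symmetric cut needs the same context on both sides, so the unit clause `neg x` is first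
  -- weakened by the literals still present in the pigeon clause. The context shrinks with each cut,
  -- and no clause outgrows the pigeon clause.
  pigeonNet : ∀ {xs} → Unique xs → length xs ≤ d →
              Net (⟪ map pos xs ⟫ ⊕ ⨁ xs (λ x → ⟪ neg x ∷ [] ⟫)) ⟪ [] ⟫ (length xs * length xs)
  pigeonNet {[]}     []         _ = none λ {δ} _ → ℕ.m≤m+n (δ []) 0
  pigeonNet {x ∷ xs} (x∉ ∷ xs!) w = relax (square-step (length xs))
    (shuffle (λ δ → ℕ.+-assoc (δ (pos x ∷ map pos xs)) (δ (neg x ∷ [])) _) ⨾
     frame (idle ∥ (weaken xs (neg x ∷ []) (All.map neg∉neg x∉)
                      (subst (_≤ d) (ℕ.+-comm 1 (length xs)) w) ▹
                    relabel (++-comm (map pos xs) (neg x ∷ []))) ⨾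
            cutNet (cut (map-pos-length xs w) (neg∉map-pos xs ∘ proj₂))) ⨾
     pigeonNet xs! (ℕ.<⇒≤ w))

  Conflict : X → X → Set
  Conflict x y = x ≢ y × H (neg x ∷ neg y ∷ [])

  -- The hole clause for `x` and `y`, weakened by the remaining positive literals, has the context
  -- `neg y ∷ map pos xs` beside `neg x`, so a cut on `x` deletes `pos x`. A fresh copy of a hole
  -- clause is assumed for each literal.
  cutAway : ∀ {xs y} → Unique xs → All (λ x → Conflict x y) xs → length xs < d →
            Net ⟪ neg y ∷ map pos xs ⟫ ⟪ neg y ∷ [] ⟫ (length xs * length xs)
  cutAway {[]}         []         []              _ = idle
  cutAway {x ∷ xs} {y} (x∉ ∷ xs!) ((x≢y , h) ∷ c) w = relax (square-step (length xs))
    (shuffle (λ δ → ℕ.+-identityʳ (δ (neg y ∷ map pos (x ∷ xs)))) ⨾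
     (relabel (swap (neg y) (pos x) ↭-refl) ∥
      (assume h ⨾
       weaken xs (neg x ∷ neg y ∷ [])
         (All.zipWith (λ (x≢z , z≢y , _) → λ where
             (here refl)         → x≢z refl
             (there (here refl)) → z≢y refl) (x∉ , c))
         (subst (_≤ d) (ℕ.+-comm 2 (length xs)) w) ▹
       relabel (++-comm (map pos xs) _))) ⨾
     cutNet (cut (ℕ.<-≤-trans (s≤s (s≤s (ℕ.≤-reflexive (List.length-map pos xs)))) w)
       λ where
         (_ , here refl) → x≢y refl
         (_ , there i)   → neg∉map-pos xs i) ⨾
     cutAway xs! c (ℕ.<⇒≤ w))

  -- The clause xs is split on y; the branch with ¬y loses xs to the hole clauses.
  holeNet : ∀ {xs ys} → Unique xs → All (λ y → All (λ x → Conflict x y) xs) ys →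
            AllPairs Conflict ys → length xs + length ys ≤ d →
            Net ⟪ map pos xs ⟫ (⨁ ys (λ y → ⟪ neg y ∷ [] ⟫)) (length ys * (1 + d * d))
  holeNet {xs} {[]}     xs! []      []       _ = none λ _ → z≤n
  holeNet {xs} {y ∷ ys} xs! (c ∷ cs) (p ∷ ps) w =
    relax (ℕ.+-monoʳ-≤ 1 (ℕ.+-monoˡ-≤ _ (ℕ.*-mono-≤ (ℕ.<⇒≤ xs<d) (ℕ.<⇒≤ xs<d))))
      (splitNet (split (map-pos-length xs xs<d) (neg∉map-pos xs ∘ proj₂)) ⨾
       (⊕-comm _ ⟪ neg y ∷ map pos xs ⟫ ⨾
        (cutAway xs! c xs<d ∥
         holeNet (All.map (λ (x≢y , _) y≡x → x≢y (sym y≡x)) c ∷ xs!)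
           (All.zipWith (λ (q , qs) → q ∷ qs) (p , cs)) ps
           (subst (_≤ d) (ℕ.+-suc (length xs) (length ys)) w))))
    where
    xs<d : length xs < d
    xs<d = ℕ.<-≤-trans (ℕ.m<m+n (length xs) (s≤s z≤n)) w

-- From nets to circular refutations

-- The recursion follows that of `sumℝ` on copies of `1ℝ`, so every term of the sequence of a sum of
-- unit flows is the image of a count.
ι : ℕ → ℚ
ι zero    = 0ℚ
ι (suc n) = 1ℚ ℚ.+ ι n

0≤ι : ∀ n → 0ℚ ℚ.≤ ι n
0≤ι zero    = ℚ.≤-refl
0≤ι (suc n) = ℚ.+-mono-≤ (ℚ.nonNegative⁻¹ 1ℚ) (0≤ι n)

ι-mono-≤ : ∀ {a b} → a ≤ b → ι a ℚ.≤ ι b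
ι-mono-≤ {b = b} z≤n = 0≤ι b
ι-mono-≤ (s≤s a≤b)   = ℚ.+-monoʳ-≤ 1ℚ (ι-mono-≤ a≤b)

1ℝ : ℝ
1ℝ .seq _ = 1ℚ
1ℝ .cauchy 0<ε = 0 , λ _ _ → 0<ε

0<1ℝ : 0ℝ <ℝ 1ℝ
0<1ℝ = 1ℚ , ℚ.positive⁻¹ 1ℚ , 0 , λ _ → ℚ.≤-refl

sum-1ℝ : ∀ (xs : List Y) i → seq (sumℝ (map (λ _ → 1ℝ) xs)) i ≡ ι (length xs)
sum-1ℝ []       i = refl
sum-1ℝ (x ∷ xs) i = cong (1ℚ ℚ.+_) (sum-1ℝ xs i)

module _ (xs : List Y) (ys : List Z) where

  private
    difference = sumℝ (map (λ _ → 1ℝ) xs) -ℝ sumℝ (map (λ _ → 1ℝ) ys)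

    seq-difference : ∀ i → seq difference i ≡ ι (length xs) ℚ.- ι (length ys)
    seq-difference i = cong₂ ℚ._-_ (sum-1ℝ xs i) (sum-1ℝ ys i)

  negative-difference : difference <ℝ 0ℝ → length xs < length ys
  negative-difference (ε , 0<ε , N , p) = ℕ.≰⇒> λ ys≤xs → ℚ.<-irrefl refl (begin-strict
    0ℚ                                        <⟨ 0<ε ⟩
    ε                                         ≡⟨ ℚ.+-identityˡ ε ⟨
    0ℚ ℚ.+ ε                                  ≡⟨ cong (ℚ._+ ε) (ℚ.+-inverseʳ (ι (length ys))) ⟨
    (ι (length ys) ℚ.- ι (length ys)) ℚ.+ ε   ≤⟨ ℚ.+-monoˡ-≤ ε
                                                   (ℚ.+-monoˡ-≤ (ℚ.- ι (length ys)) (ι-mono-≤ ys≤xs)) ⟩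
    (ι (length xs) ℚ.- ι (length ys)) ℚ.+ ε   ≡⟨ cong (ℚ._+ ε) (seq-difference N) ⟨
    seq difference N ℚ.+ ε                    ≤⟨ p ℕ.≤-refl ⟩
    0ℚ                                        ∎)
    where open ℚ.≤-Reasoning

  positive-difference : length ys < length xs → 0ℝ <ℝ difference
  positive-difference ys<xs = 1ℚ , ℚ.positive⁻¹ 1ℚ , 0 , λ {i} _ → begin
    0ℚ ℚ.+ 1ℚ
      ≡⟨ solve 1 (λ y → con 0ℚ :+ con 1ℚ := (con 1ℚ :+ y) :- y) refl (ι (length ys)) ⟩
    ι (suc (length ys)) ℚ.- ι (length ys)
      ≤⟨ ℚ.+-monoˡ-≤ (ℚ.- ι (length ys)) (ι-mono-≤ ys<xs) ⟩
    ι (length xs) ℚ.- ι (length ys)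
      ≡⟨ seq-difference i ⟨
    seq difference i ∎
    where
    open ℚ.≤-Reasoning
    open ℚ.+-*-Solver

-- Counting with indicators

⟦_⟧ : ∀ {P : Set} → Dec P → ℕ
⟦ yes _ ⟧ = 1
⟦ no _ ⟧  = 0

⟦⟧-cong : ∀ {P Q : Set} (p : Dec P) (q : Dec Q) → (P → Q) → (Q → P) → ⟦ p ⟧ ≡ ⟦ q ⟧
⟦⟧-cong (yes _) (yes _) _ _ = refl
⟦⟧-cong (yes p) (no ¬q) f _ = contradiction (f p) ¬q
⟦⟧-cong (no ¬p) (yes q) _ g = contradiction (g q) ¬p
⟦⟧-cong (no _)  (no _)  _ _ = refl

length-filter-∑ : ∀ {P : Pred Y _} (P? : Decidable P) xs → length (filter P? xs) ≡ ∑ xs (⟦_⟧ ∘ P?)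
length-filter-∑ P? []       = refl
length-filter-∑ P? (x ∷ xs) with P? x
... | yes _ = cong suc (length-filter-∑ P? xs)
... | no _  = length-filter-∑ P? xs

length-deduplicate : ∀ {R : Y → Y → Set} (R? : ∀ x y → Dec (R x y)) xs →
                     length (deduplicate R? xs) ≤ length xs
length-deduplicate R? []       = z≤n
length-deduplicate R? (x ∷ xs) = s≤s (ℕ.≤-trans
  (List.length-filter (¬? ∘ R? x) (deduplicate R? xs)) (length-deduplicate R? xs))

∑-cong : ∀ {f g : Y → ℕ} → (∀ y → f y ≡ g y) → ∀ ys → ∑ ys f ≡ ∑ ys g
∑-cong f≡g []       = refl
∑-cong f≡g (y ∷ ys) = cong₂ _+_ (f≡g y) (∑-cong f≡g ys)

∑-lookup : ∀ (xs : List Y) f → ∑ (allFin (length xs)) (f ∘ lookup xs) ≡ ∑ xs f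
∑-lookup xs f = cong sum (trans (List.map-tabulate id (f ∘ lookup xs))
  (trans (sym (List.map-tabulate (lookup xs) f)) (cong (map f) (List.tabulate-lookup xs))))

lookup-injective : ∀ {_≈_ : Y → Y → Set} → (∀ {x y} → x ≈ y → y ≈ x) →
                   ∀ {xs} → AllPairs (λ x y → ¬ x ≈ y) xs →
                   ∀ i j → lookup xs i ≈ lookup xs j → i ≡ j
lookup-injective s (_ ∷ _)  zero    zero    _ = refl
lookup-injective s (p ∷ _)  zero    (suc j) e = contradiction e (All.lookup p (∈-lookup j))
lookup-injective s (p ∷ _)  (suc i) zero    e = contradiction (s e) (All.lookup p (∈-lookup i))
lookup-injective s (_ ∷ ps) (suc i) (suc j) e = cong suc (lookup-injective s ps i j e)

max-attained : ∀ (f : Y → ℕ) {xs x} → All (λ y → f y ≤ f x) xs → x ∈ xs → max 0 (map f xs) ≡ f x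
max-attained f {xs} {x} bound x∈xs = ℕ.≤-antisym
  (max≤v⁺ z≤n (All.map⁺ bound))
  (v≤max⁺ 0 (map f xs) (inj₂ (Any.map⁺ (Any.map (λ { refl → ℕ.≤-refl }) x∈xs))))

module _ {p q x y h : ℕ} (p<q : p < q) where

  open ℕ.≤-Reasoning

  -- This is the conservation law at one vertex: `p` and `q` count the empty clauses consumed and
  -- produced, `a` tells whether the vertex carries the empty clause, `h` counts the hypotheses
  -- there, `x` and `y` the inferences leaving and entering the vertex.
  surplus : ∀ a → h ≡ 0 → q * a + x ≤ p * a + (h + y) → x ≤ y
  surplus a refl c = ℕ.+-cancelˡ-≤ (p * a) _ _ (begin
    p * a + x ≤⟨ ℕ.+-monoˡ-≤ x (ℕ.*-monoˡ-≤ a (ℕ.<⇒≤ p<q)) ⟩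
    q * a + x ≤⟨ c ⟩
    p * a + y ∎)

  strict-surplus : ∀ {a} → a ≡ 1 → h ≡ 0 → q * a + x ≤ p * a + (h + y) → x < y
  strict-surplus refl refl c = ℕ.+-cancelˡ-< (p * 1) _ _ (begin-strict
    p * 1 + x <⟨ ℕ.+-monoˡ-< x (ℕ.*-monoˡ-< 1 p<q) ⟩
    q * 1 + x ≤⟨ c ⟩
    p * 1 + y ∎)

-- Circular pre-proofs with one vertex for each class of clauses

module Realize {X : Set} (_≟_ : DecidableEquality X) (H : Clause X → Set) (d : ℕ) where

  open CircularResolution _≟_
  open Nets _≟_ H d

  open import Data.List.Relation.Binary.Subset.DecPropositional _≟ˡ_ using (_⊆?_)
  open Setoid ([ set ]-Equality (Literal X)) using ()
    renaming (refl to ≋-refl; sym to ≋-sym; trans to ≋-trans)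

  ≋-reflexive : ∀ {C D : Clause X} → C ≡ D → C ≋ D
  ≋-reflexive refl = ≋-refl

  infix 4 _≋?_
  _≋?_ : (C D : Clause X) → Dec (C ≋ D)
  C ≋? D = map′ antisym both ((C ⊆? D) ×-dec (D ⊆? C))
    where
    antisym : C ⊆ D × D ⊆ C → C ≋ D
    antisym (f , g) = mk⇔ f g
    both : C ≋ D → C ⊆ D × D ⊆ C
    both e = Equivalence.to e , Equivalence.from e

  ≋-decSetoid : DecSetoid _ _
  ≋-decSetoid = record
    { isDecEquivalence = record
      { isEquivalence = Setoid.isEquivalence ([ set ]-Equality (Literal X)) ; _≟_ = _≋?_ } }

  ∣∣ᶜ≤length : ∀ C → ∣ C ∣ᶜ ≤ length C
  ∣∣ᶜ≤length = length-deduplicate _≟ˡ_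

  width-attained : ∀ Π u → (∀ v → ∣ label Π v ∣ᶜ ≤ ∣ label Π u ∣ᶜ) → width Π ≡ ∣ label Π u ∣ᶜ
  width-attained Π u bound =
    max-attained (λ v → ∣ label Π v ∣ᶜ) (All.tabulate λ {v} _ → bound v) (∈-allFin u)

  unitFlow : ∀ Π → Fin (#I Π) → ℝ
  unitFlow Π _ = 1ℝ

  module _ (Π : PreProof) (u : Fin (#J Π)) where

    negative-balance : balance Π (unitFlow Π) u <ℝ 0ℝ → length (N⁻ Π u) < length (N⁺ Π u)
    negative-balance = negative-difference (N⁻ Π u) (N⁺ Π u)

    positive-balance : length (N⁺ Π u) < length (N⁻ Π u) → 0ℝ <ℝ balance Π (unitFlow Π) u
    positive-balance = positive-difference (N⁻ Π u) (N⁺ Π u)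

  Apart : List (Clause X) → Set
  Apart = AllPairs (λ C D → ¬ C ≋ D)

  pos≉neg : ∀ {C : Clause X} {x} → ¬ (pos x ∈ C × neg x ∈ C) → ¬ (pos x ∷ C) ≋ (neg x ∷ C)
  pos≉neg {C} {x} ¬both e = ¬both (p , n)
    where
    p : pos x ∈ C
    p with Equivalence.to e (here refl)
    ... | there i = i
    n : neg x ∈ C
    n with Equivalence.from e (here refl)
    ... | there i = i

  premises-apart : ∀ {r} → Proper r → Apart (premises r)
  premises-apart (cut _ b)   = (pos≉neg b ∷ []) ∷ [] ∷ []
  premises-apart (split _ _) = [] ∷ []

  conclusions-apart : ∀ {r} → Proper r → Apart (conclusions r)
  conclusions-apart (cut _ _)   = [] ∷ []
  conclusions-apart (split _ b) = (pos≉neg b ∷ []) ∷ [] ∷ []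

  clauses : Rule → List (Clause X)
  clauses r = premises r ++ conclusions r

  clauses-narrow : ∀ {r} → Proper r → All (λ C → length C ≤ d) (clauses r)
  clauses-narrow (cut w _)   = w ∷ w ∷ ℕ.<⇒≤ w ∷ []
  clauses-narrow (split w _) = ℕ.<⇒≤ w ∷ w ∷ w ∷ []

  length-clauses : ∀ {r} → Proper r → length (clauses r) ≡ 3
  length-clauses (cut _ _)   = refl
  length-clauses (split _ _) = refl

  -- The clause pad only serves to make the width exactly d.
  module _ (pad : Clause X) (rules : List Rule) (proper : All Proper rules) where

    private
      labels nodes : List (Clause X)
      -- The empty clause is listed explicitly so that the intended sink exists whatever the rules
      -- are.
      labels = pad ∷ [] ∷ concatMap clauses rules
      nodes  = deduplicate _≋?_ labels

      Labelled : List (Fin (length nodes)) → List (Clause X) → Set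
      Labelled = Pointwise (λ u C → lookup nodes u ≋ C)

      node : ∀ {C} → C ∈ labels → ∃[ u ] lookup nodes u ≋ C
      node {C} i = Any.index j , ≋-sym (Any.lookup-index j)
        where
        j : Any (C ≋_) nodes
        j = Any.deduplicate⁺ _≋?_ (λ {D} {E} E≋D C≋D → ≋-trans C≋D (≋-sym E≋D))
              (Any.map ≋-reflexive i)

      attach : ∀ Cs → All (_∈ labels) Cs → ∃[ us ] Labelled us Cs
      attach []       []       = [] , []
      attach (C ∷ Cs) (i ∷ is) =
        let u  , p  = node i
            us , ps = attach Cs is
        in u ∷ us , p ∷ ps

      -- A repeated vertex would carry a label equivalent to two clauses that are apart.
      attach-unique : ∀ {us Cs} → Labelled us Cs → Apart Cs → Unique us
      attach-unique []       []       = []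
      attach-unique (p ∷ ps) (a ∷ as) = distinct p ps a ∷ attach-unique ps as
        where
        distinct : ∀ {u C us Cs} → lookup nodes u ≋ C → Labelled us Cs →
                   All (λ D → ¬ C ≋ D) Cs → All (u ≢_) us
        distinct p []       []       = []
        distinct p (q ∷ qs) (b ∷ bs) = (λ { refl → b (≋-trans (≋-sym p) q) }) ∷ distinct p qs bs

      clause∈labels : ∀ {r} → r ∈ rules → All (_∈ labels) (clauses r)
      clause∈labels i = All.tabulate λ j →
        there (there (∈-concatMap⁺ clauses (Any.map (λ { refl → j }) i)))

      lookup-proper : ∀ w → Proper (lookup rules w)
      lookup-proper w = All.lookup proper (∈-lookup w)

      into : ∀ w → ∃[ us ] Labelled us (premises (lookup rules w))
      into w = attach _ (All.++⁻ˡ _ (clause∈labels (∈-lookup w)))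

      from : ∀ w → ∃[ us ] Labelled us (conclusions (lookup rules w))
      from w = attach _ (All.++⁻ʳ (premises (lookup rules w)) (clause∈labels (∈-lookup w)))

    -- A clause concluded by one inference and used by another is a single vertex, so the inferences
    -- become linked without any explicit wiring. Repeated uses of a rule remain separate
    -- inference-vertices, which lets unit flow count multiplicities.
    realization : PreProof
    realization = record
      { #J          = length nodes
      ; #I          = length rules
      ; label       = lookup nodes
      ; rule        = lookup rules
      ; ins         = proj₁ ∘ into
      ; outs        = proj₁ ∘ from
      ; ins-unique  = λ w → attach-unique (proj₂ (into w)) (premises-apart (lookup-proper w))
      ; outs-unique = λ w → attach-unique (proj₂ (from w)) (conclusions-apart (lookup-proper w))
      ; ins-label   = proj₂ ∘ into
      ; outs-label  = proj₂ ∘ from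
      }

    -- As an instance of the weight in `conserve`, this turns the conservation law of a net into a
    -- comparison of in-degree and out-degree at `u`.
    indicator : Fin (length nodes) → Weight
    indicator u C = ⟦ lookup nodes u ≋? C ⟧

    indicator-invariant : ∀ u → Invariant (indicator u)
    indicator-invariant u C≋D = ⟦⟧-cong (lookup nodes u ≋? _) (lookup nodes u ≋? _)
      (λ e → ≋-trans e C≋D) (λ e → ≋-trans e (≋-sym C≋D))

    private
      nodes-apart : Apart nodes
      nodes-apart = deduplicate-! ≋-decSetoid labels

      -- Distinct vertices have inequivalent labels, so a clause of `Cs` is equivalent to the label
      -- of `u` only if its vertex is `u`; as `us` has no repetition, this happens at most once.
      incidence : ∀ u {us Cs} → Labelled us Cs → Unique us →
                  ⟦ any? (u Fin.≟_) us ⟧ ≡ ∑ Cs (indicator u)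
      incidence u []                             []         = refl
      incidence u {v ∷ us} {C ∷ Cs} (p ∷ ps) (v∉ ∷ us!) = go (u Fin.≟ v) (lookup nodes u ≋? C)
        where
        go : Dec (u ≡ v) → (q : Dec (lookup nodes u ≋ C)) →
             ⟦ any? (u Fin.≟_) (v ∷ us) ⟧ ≡ ⟦ q ⟧ + ∑ Cs (indicator u)
        go (yes refl) (no ¬q) = ⊥-elim (¬q p)
        go (no u≢v)   (yes q) =
          contradiction (lookup-injective ≋-sym nodes-apart u v (≋-trans q (≋-sym p))) u≢v
        go (no u≢v)   (no _)  = trans
          (⟦⟧-cong (any? (u Fin.≟_) (v ∷ us)) (any? (u Fin.≟_) us) (Any.tail u≢v) there)
          (incidence u ps us!)
        go (yes refl) (yes _) = trans
          (⟦⟧-cong (any? (u Fin.≟_) (v ∷ us)) (yes tt) (λ _ → tt) (λ _ → here refl))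
          (cong suc (trans
            (⟦⟧-cong (no λ (x : ⊥) → x) (any? (u Fin.≟_) us) ⊥-elim λ i → All.lookup v∉ i refl)
            (incidence u ps us!)))

    length-N⁻ : ∀ u → length (N⁻ realization u) ≡ ∑ rules (λ r → ∑ (conclusions r) (indicator u))
    length-N⁻ u = trans
      (length-filter-∑ (λ w → any? (u Fin.≟_) (proj₁ (from w))) (allFin _)) (trans
      (∑-cong (λ w → incidence u (proj₂ (from w)) (outs-unique realization w)) (allFin _))
      (∑-lookup rules _))

    length-N⁺ : ∀ u → length (N⁺ realization u) ≡ ∑ rules (λ r → ∑ (premises r) (indicator u))
    length-N⁺ u = trans
      (length-filter-∑ (λ w → any? (u Fin.≟_) (proj₁ (into w))) (allFin _)) (trans
      (∑-cong (λ w → incidence u (proj₂ (into w)) (ins-unique realization w)) (allFin _))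
      (∑-lookup rules _))

    width-realization : ∣ pad ∣ᶜ ≡ d → width realization ≡ d
    width-realization refl =
      -- Deduplication keeps the head of the list, so vertex `zero` is labelled by `pad`.
      width-attained realization zero λ u → All.lookup narrow (∈-lookup u)
      where
      narrow : All (λ C → ∣ C ∣ᶜ ≤ d) nodes
      narrow = All.deduplicate⁺ _≋?_ (ℕ.≤-refl ∷ z≤n ∷ All.concat⁺ (All.map⁺
        (All.map (λ g → All.map (λ {C} → ℕ.≤-trans (∣∣ᶜ≤length C)) (clauses-narrow g)) proper)))

    -- Each rule brings one inference-vertex and at most three new clauses; the 2 stands for `pad`
    -- and the empty clause.
    size-realization : size realization ≤ 2 + 4 * length rules
    size-realization = begin
      length nodes + length rules
        ≤⟨ ℕ.+-monoˡ-≤ _ (length-deduplicate _≋?_ labels) ⟩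
      length labels + length rules
        ≡⟨ cong (λ l → 2 + l + length rules) (length-concatMap proper) ⟩
      2 + 3 * length rules + length rules
        ≡⟨ solve 1 (λ r → con 2 :+ con 3 :* r :+ r := con 2 :+ con 4 :* r) refl (length rules) ⟩
      2 + 4 * length rules ∎
      where
      open ℕ.≤-Reasoning
      open +-*-Solver
      length-concatMap : ∀ {rs} → All Proper rs → length (concatMap clauses rs) ≡ 3 * length rs
      length-concatMap []       = refl
      length-concatMap {r ∷ rs} (g ∷ gs) = trans (List.length-++ (clauses r))
        (trans (cong₂ _+_ (length-clauses g) (length-concatMap gs)) (sym (ℕ.*-suc 3 (length rs))))

    emptyNode : ∃[ u ] label realization u ≋ []
    emptyNode = node (there (here refl))

    ∑-indicator : ∀ u Cs → ∑ Cs (indicator u) ≡ 0 ⊎ ∃[ C ] C ∈ Cs × label realization u ≋ C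
    ∑-indicator u []       = inj₁ refl
    ∑-indicator u (C ∷ Cs) with lookup nodes u ≋? C
    ... | yes e = inj₂ (C , here refl , e)
    ... | no _  with ∑-indicator u Cs
    ...   | inj₁ e           = inj₁ e
    ...   | inj₂ (D , i , e) = inj₂ (D , there i , e)

  -- At a vertex without hypotheses, `p < q` leaves no deficit, so every source carries a
  -- hypothesis. As no clause of `H` is empty, no hypothesis enters at the vertex of the empty
  -- clause, and the gain of `q` over `p` becomes a strict surplus there.
  realize : ∀ {k p q} → Net (λ δ → p * δ []) (λ δ → q * δ []) k → p < q →
            (∀ {C} → H C → ¬ C ≋ []) → ∀ pad → ∣ pad ∣ᶜ ≡ d →
            ∃[ Π ] IsRefutation H Π × size Π ≤ 2 + 4 * k × width Π ≡ d
  realize {k} {p} {q} N p<q H≉[] pad ∣pad∣ =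
    Π , isRefutation ,
    ℕ.≤-trans (size-realization pad (rules N) (proper N))
              (ℕ.+-monoʳ-≤ 2 (ℕ.*-monoʳ-≤ 4 (short N))) ,
    width-realization pad (rules N) (proper N) ∣pad∣
    where
    Π = realization pad (rules N) (proper N)
    δ = indicator pad (rules N) (proper N)

    conserve′ : ∀ u → q * δ u [] + length (N⁺ Π u) ≤
                      p * δ u [] + (∑ (hyps N) (δ u) + length (N⁻ Π u))
    conserve′ u = subst₂ (λ x y → q * δ u [] + x ≤ p * δ u [] + (∑ (hyps N) (δ u) + y))
      (sym (length-N⁺ pad (rules N) (proper N) u)) (sym (length-N⁻ pad (rules N) (proper N) u))
      (conserve N (indicator-invariant pad (rules N) (proper N) u))

    Supported : Fin (#J Π) → Set
    Supported u = ∑ (hyps N) (δ u) ≡ 0 ⊎ ∃[ C ] C ∈ hyps N × label Π u ≋ C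

    supported : ∀ u → Supported u
    supported u = ∑-indicator pad (rules N) (proper N) u (hyps N)

    source : ∀ u → length (N⁻ Π u) < length (N⁺ Π u) → Supported u → ∃[ C ] H C × label Π u ≋ C
    source u N⁻<N⁺ (inj₁ ≡0)          =
      contradiction (surplus p<q (δ u []) ≡0 (conserve′ u)) (ℕ.<⇒≱ N⁻<N⁺)
    source u N⁻<N⁺ (inj₂ (C , i , e)) = C , All.lookup (hyps∈H N) i , e

    sink : ∀ u → label Π u ≋ [] → Supported u → length (N⁺ Π u) < length (N⁻ Π u)
    sink u u≋[] (inj₁ ≡0)          = strict-surplus p<q
      (⟦⟧-cong (label Π u ≋? []) (yes tt) (λ _ → tt) (λ _ → u≋[])) ≡0 (conserve′ u)
    sink u u≋[] (inj₂ (C , i , e)) =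
      ⊥-elim (H≉[] (All.lookup (hyps∈H N) i) (≋-trans (≋-sym e) u≋[]))

    isRefutation : IsRefutation H Π
    isRefutation = record
      { flow     = unitFlow Π
      ; positive = λ _ → 0<1ℝ
      ; sources  = λ u neg → source u (negative-balance Π u neg) (supported u)
      ; sink     = let u , e = emptyNode pad (rules N) (proper N)
                   in u , positive-balance Π u (sink u e (supported u)) , e
      }

  -- An empty hypothesis is a source, so the derived empty clause needs a vertex of its own.
  module Trivial (x : X) (pad : Clause X) where

    trivial : PreProof
    trivial = record
      { #J          = 5
      ; #I          = 2
      ; label       = lab
      ; rule        = λ { 0F → split [] x ; 1F → cut [] x }
      ; ins         = λ { 0F → 0F ∷ [] ; 1F → 1F ∷ 2F ∷ [] }
      ; outs        = λ { 0F → 1F ∷ 2F ∷ [] ; 1F → 3F ∷ [] }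
      ; ins-unique  = λ { 0F → [] ∷ [] ; 1F → ((λ ()) ∷ []) ∷ [] ∷ [] }
      ; outs-unique = λ { 0F → ((λ ()) ∷ []) ∷ [] ∷ [] ; 1F → [] ∷ [] }
      ; ins-label   = λ { 0F → ≋-refl ∷ [] ; 1F → ≋-refl ∷ ≋-refl ∷ [] }
      ; outs-label  = λ { 0F → ≋-refl ∷ ≋-refl ∷ [] ; 1F → ≋-refl ∷ [] }
      }
      where
      lab : Fin 5 → Clause X
      lab 0F = []
      lab 1F = pos x ∷ []
      lab 2F = neg x ∷ []
      lab 3F = []
      lab 4F = pad

    trivial-refutes : H [] → IsRefutation H trivial
    trivial-refutes h = record
      { flow     = unitFlow trivial
      ; positive = λ _ → 0<1ℝ
      ; sources  = λ u neg → source u (negative-balance trivial u neg)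
      ; sink     = 3F , positive-balance trivial 3F (ℕ.≤-refl {1}) , ≋-refl
      }
      where
      source : ∀ u → length (N⁻ trivial u) < length (N⁺ trivial u) → ∃[ C ] H C × label trivial u ≋ C
      source 0F _ = [] , h , ≋-refl
      source 1F p = contradiction p (ℕ.<-irrefl {1} refl)
      source 2F p = contradiction p (ℕ.<-irrefl {1} refl)
      source 3F p = contradiction p (ℕ.n≮0 {1})
      source 4F p = contradiction p (ℕ.n≮0 {0})

    width-trivial : 1 ≤ d → ∣ pad ∣ᶜ ≡ d → width trivial ≡ d
    width-trivial 1≤d ∣pad∣ = trans (width-attained trivial 4F narrow) ∣pad∣
      where
      1≤∣pad∣ : 1 ≤ ∣ pad ∣ᶜ
      1≤∣pad∣ = subst (1 ≤_) (sym ∣pad∣) 1≤d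
      narrow : ∀ u → ∣ label trivial u ∣ᶜ ≤ ∣ pad ∣ᶜ
      narrow 0F = z≤n
      narrow 1F = 1≤∣pad∣
      narrow 2F = 1≤∣pad∣
      narrow 3F = z≤n
      narrow 4F = ℕ.≤-refl

  realize-trivial : H [] → 1 ≤ d → X → ∀ pad → ∣ pad ∣ᶜ ≡ d →
                    ∃[ Π ] IsRefutation H Π × size Π ≤ 7 × width Π ≡ d
  realize-trivial h 1≤d x pad ∣pad∣ =
    trivial , trivial-refutes h , ℕ.≤-refl {7} , width-trivial 1≤d ∣pad∣
    where open Trivial x pad

-- Incidences in a bipartite graph

length-allFin : ∀ k → length (allFin k) ≡ k
length-allFin k = List.length-tabulate {n = k} id

∑-const : ∀ (xs : List Y) c → ∑ xs (λ _ → c) ≡ length xs * c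
∑-const []       c = refl
∑-const (x ∷ xs) c = cong (c +_) (∑-const xs c)

∑-+ : ∀ (xs : List Y) f g → ∑ xs (λ x → f x + g x) ≡ ∑ xs f + ∑ xs g
∑-+ []       f g = refl
∑-+ (x ∷ xs) f g = trans (cong (f x + g x +_) (∑-+ xs f g))
  (solve 4 (λ a b c d → (a :+ b) :+ (c :+ d) := (a :+ c) :+ (b :+ d)) refl
    (f x) (g x) (∑ xs f) (∑ xs g))
  where open +-*-Solver

∑-swap : ∀ (xs : List Y) (ys : List Z) (f : Y → Z → ℕ) →
         ∑ xs (λ x → ∑ ys (f x)) ≡ ∑ ys (λ y → ∑ xs (λ x → f x y))
∑-swap []       ys f = sym (trans (∑-const ys 0) (ℕ.*-zeroʳ (length ys)))
∑-swap (x ∷ xs) ys f = trans (cong (∑ ys (f x) +_) (∑-swap xs ys f)) (sym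
  (∑-+ ys (f x) (λ y → ∑ xs (λ x → f x y))))

∑-mapMaybe : ∀ (f : Y → Maybe Z) xs g → ∑ (mapMaybe f xs) g ≡ ∑ xs (maybe′ g 0 ∘ f)
∑-mapMaybe f []       g = refl
∑-mapMaybe f (x ∷ xs) g with f x
... | just z  = cong (g z +_) (∑-mapMaybe f xs g)
... | nothing = ∑-mapMaybe f xs g

mapMaybe-AllPairs : ∀ {R : Z → Z → Set} (f : Y → Maybe Z) {xs} →
                    AllPairs (λ x y → ∀ {a b} → f x ≡ just a → f y ≡ just b → R a b) xs →
                    AllPairs R (mapMaybe f xs)
mapMaybe-AllPairs f []       = []
mapMaybe-AllPairs {R = R} f {x ∷ xs} (p ∷ ps) with f x in eq
... | nothing = mapMaybe-AllPairs f ps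
... | just a  = go p ∷ mapMaybe-AllPairs f ps
  where
  go : ∀ {ys} → All (λ y → ∀ {a′ b} → just a ≡ just a′ → f y ≡ just b → R a′ b) ys →
       All (R a) (mapMaybe f ys)
  go []       = []
  go {y ∷ ys} (q ∷ qs) with f y
  ... | nothing = go qs
  ... | just b  = q refl refl ∷ go qs

deduplicate-unique : (_≟_ : DecidableEquality Y) → ∀ {xs} → Unique xs → deduplicate _≟_ xs ≡ xs
deduplicate-unique _≟_ []                  = refl
deduplicate-unique _≟_ {x ∷ xs} (x∉ ∷ xs!) =
  cong (x ∷_) (trans (cong (filter (¬? ∘ _≟_ x)) (deduplicate-unique _≟_ xs!))
                     (List.filter-all (¬? ∘ _≟_ x) x∉))

-- The refutation of the graph pigeonhole principle

module _ {m n d : ℕ} (G : BipartiteGraph m n) (maxDegree≡d : maxDegree G ≡ d) where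

  open Edge

  private
    N = m + n

  open CircularResolution (_≟ᵉ_ G)
  open Nets (_≟ᵉ_ G) (PHP G) d
  open Realize (_≟ᵉ_ G) (PHP G) d

  edge?-ends : ∀ {u v e} → edge? G u v ≡ just e → left e ≡ u × right e ≡ v
  edge?-ends {u} {v} eq with T? (G u v) | eq
  ... | yes _ | refl = refl , refl
  ... | no _  | ()

  incidentˡ-unique : ∀ u → Unique (incidentˡ G u)
  incidentˡ-unique u = mapMaybe-AllPairs (edge? G u) (AllPairs.tabulate⁺ {f = id} λ i≢j p q e≡e′ →
    i≢j (trans (sym (proj₂ (edge?-ends p))) (trans (cong right e≡e′) (proj₂ (edge?-ends q)))))

  incidentʳ-conflict : ∀ v → AllPairs Conflict (incidentʳ G v)
  incidentʳ-conflict v = mapMaybe-AllPairs (λ u → edge? G u v) (AllPairs.tabulate⁺ {f = id} λ i≢j p q →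
    let l≢l′ = λ l≡l′ → i≢j (trans (sym (proj₁ (edge?-ends p))) (trans l≡l′ (proj₁ (edge?-ends q))))
    in (l≢l′ ∘ cong left) , hole _ _ l≢l′ (trans (proj₂ (edge?-ends p)) (sym (proj₂ (edge?-ends q)))))

  incidentʳ-unique : ∀ v → Unique (incidentʳ G v)
  incidentʳ-unique v = AllPairs.map proj₁ (incidentʳ-conflict v)

  private
    degrees : List ℕ
    degrees = map (length ∘ incidentˡ G) (allFin m) ++ map (length ∘ incidentʳ G) (allFin n)

  degreeˡ≤ : ∀ u → length (incidentˡ G u) ≤ d
  degreeˡ≤ u = subst (_ ≤_) maxDegree≡d
    (All.lookup (xs≤max 0 degrees) (∈-++⁺ˡ (∈-map⁺ _ (∈-allFin u))))

  degreeʳ≤ : ∀ v → length (incidentʳ G v) ≤ d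
  degreeʳ≤ v = subst (_ ≤_) maxDegree≡d
    (All.lookup (xs≤max 0 degrees) (∈-++⁺ʳ _ (∈-map⁺ _ (∈-allFin v))))

  length-mapMaybe-allFin : ∀ {k} (f : Fin k → Maybe (Edge G)) → length (mapMaybe f (allFin k)) ≤ k
  length-mapMaybe-allFin {k} f =
    ℕ.≤-trans (List.length-mapMaybe f (allFin k)) (ℕ.≤-reflexive (length-allFin k))

  -- The positive literals of these `d` distinct edges form the clause that gives the refutation
  -- width exactly `d`; `d ≤ N` serves the size bound.
  maxDegree-attained : 1 ≤ d → ∃[ es ] Unique es × length {A = Edge G} es ≡ d × d ≤ N
  maxDegree-attained 1≤d with argmax-sel id 0 degrees
  ... | inj₁ ≡0 = contradiction (subst (1 ≤_) (trans (sym maxDegree≡d) ≡0) 1≤d) λ ()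
  ... | inj₂ max∈ with ∈-++⁻ (map (length ∘ incidentˡ G) (allFin m)) max∈
  ...   | inj₁ i with u , _ , eq ← ∈-map⁻ _ i =
    let d≡ = trans (sym maxDegree≡d) eq
    in incidentˡ G u , incidentˡ-unique u , sym d≡ ,
       ℕ.≤-trans (ℕ.≤-reflexive d≡) (ℕ.≤-trans (length-mapMaybe-allFin (edge? G u)) (ℕ.m≤n+m n m))
  ...   | inj₂ i with v , _ , eq ← ∈-map⁻ _ i =
    let d≡ = trans (sym maxDegree≡d) eq
    in incidentʳ G v , incidentʳ-unique v , sym d≡ ,
       ℕ.≤-trans (ℕ.≤-reflexive d≡) (ℕ.≤-trans (length-mapMaybe-allFin (λ u → edge? G u v))
                                              (ℕ.m≤m+n m n))

  -- Both sides are sums over all pairs in U × V in which non-edges contribute 0. This regroups the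
  -- clauses ¬X_e, produced hole by hole, into those consumed pigeon by pigeon.
  double-counting : ∀ (f : Edge G → ℕ) →
    ∑ (allFin m) (λ u → ∑ (incidentˡ G u) f) ≡ ∑ (allFin n) (λ v → ∑ (incidentʳ G v) f)
  double-counting f = begin
    ∑ (allFin m) (λ u → ∑ (incidentˡ G u) f)
      ≡⟨ ∑-cong (λ u → ∑-mapMaybe (edge? G u) (allFin n) f) (allFin m) ⟩
    ∑ (allFin m) (λ u → ∑ (allFin n) (λ v → maybe′ f 0 (edge? G u v)))
      ≡⟨ ∑-swap (allFin m) (allFin n) (λ u v → maybe′ f 0 (edge? G u v)) ⟩
    ∑ (allFin n) (λ v → ∑ (allFin m) (λ u → maybe′ f 0 (edge? G u v)))
      ≡⟨ ∑-cong (λ v → ∑-mapMaybe (λ u → edge? G u v) (allFin m) f) (allFin n) ⟨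
    ∑ (allFin n) (λ v → ∑ (incidentʳ G v) f) ∎
    where open ≡-Reasoning

  copies : ∀ k δ → k * δ [] ≡ ⨁ (allFin k) (λ _ → ⟪ [] ⟫) δ
  copies k δ = sym (trans (∑-const (allFin k) (δ [])) (cong (_* δ []) (length-allFin k)))

  -- A hole costs at most `d` splits, each with at most `d * d` inferences to cut positive literals
  -- away; a pigeon costs at most `d * d`.
  matchingNet : Net (λ δ → n * δ []) (λ δ → m * δ []) (n * (d * (1 + d * d)) + m * (d * d))
  matchingNet =
    shuffle (λ δ → sym (copies n δ)) ⨾
    relax (ℕ.≤-reflexive (cong (_* (d * (1 + d * d))) (length-allFin n)))
      (parallel (allFin n) λ v → relax (ℕ.*-monoˡ-≤ (1 + d * d) (degreeʳ≤ v))
        (holeNet [] (All.universal (λ _ → []) _) (incidentʳ-conflict v) (degreeʳ≤ v))) ▹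
    shuffle (λ δ → double-counting (λ e → δ (neg e ∷ []))) ⨾
    relax (ℕ.≤-reflexive (cong (_* (d * d)) (length-allFin m)))
      (parallel (allFin m) λ u → relax (ℕ.*-mono-≤ (degreeˡ≤ u) (degreeˡ≤ u))
        (frame (assume (pigeon u)) ⨾ pigeonNet (incidentˡ-unique u) (degreeˡ≤ u))) ▹
    shuffle (copies m)

  PHP-nonempty : (∀ u → incidentˡ G u ≢ []) → ∀ {C} → PHP G C → ¬ C ≋ []
  PHP-nonempty nonempty (hole _ _ _ _) C≋[] with () ← Equivalence.to C≋[] (here refl)
  PHP-nonempty nonempty (pigeon u)     C≋[] with incidentˡ G u | nonempty u
  ... | []    | ne = ne refl
  ... | _ ∷ _ | _ with () ← Equivalence.to C≋[] (here refl)

  ∣map-pos∣ : ∀ {es} → Unique es → ∣ map pos es ∣ᶜ ≡ length es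
  ∣map-pos∣ {es} es! = trans
    (cong length (deduplicate-unique _≟ˡ_ (Unique.map⁺ (λ { refl → refl }) es!)))
    (List.length-map pos es)

  private
    empty? : ∀ u → Dec (incidentˡ G u ≡ [])
    empty? u with incidentˡ G u
    ... | []    = yes refl
    ... | _ ∷ _ = no λ ()

    -- With `1 + d * d` at most twice the square of `N`, the holes give 2 and the pigeons 1 times
    -- the fourth power of `N`, and 14 is `2 + 4 * (2 + 1)`.
    size-bound : d ≤ N → 1 ≤ N → 2 + 4 * (n * (d * (1 + d * d)) + m * (d * d)) ≤ 14 * N ^ 4
    size-bound d≤N 1≤N = begin
      2 + 4 * (n * (d * (1 + d * d)) + m * (d * d))
        ≤⟨ ℕ.+-monoʳ-≤ 2 (ℕ.*-monoʳ-≤ 4 (ℕ.+-mono-≤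
             (ℕ.*-mono-≤ (ℕ.m≤n+m n m) (ℕ.*-mono-≤ d≤N (ℕ.+-mono-≤ (ℕ.*-mono-≤ 1≤N 1≤N) d²≤N²)))
             (ℕ.≤-trans (ℕ.≤-reflexive (sym (ℕ.*-identityˡ _)))
                        (ℕ.*-mono-≤ 1≤N (ℕ.*-mono-≤ (ℕ.m≤m+n m n) d²≤N²))))) ⟩
      2 + 4 * (N * (N * (N * N + N * N)) + N * (N * (N * N)))
        ≤⟨ ℕ.+-monoˡ-≤ _ (ℕ.*-monoʳ-≤ 2 (ℕ.^-monoˡ-≤ 4 1≤N)) ⟩
      2 * N ^ 4 + 4 * (N * (N * (N * N + N * N)) + N * (N * (N * N)))
        ≡⟨ solve 1 (λ x → con 2 :* x :^ 4 :+ con 4 :* (x :* (x :* (x :* x :+ x :* x))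
                                                :+ x :* (x :* (x :* x)))
                       := con 14 :* x :^ 4) refl N ⟩
      14 * N ^ 4 ∎
      where
      open ℕ.≤-Reasoning
      open +-*-Solver
      d²≤N² : d * d ≤ N * N
      d²≤N² = ℕ.*-mono-≤ d≤N d≤N

    enlarge : ∀ {k l} → k ≤ l →
              ∃[ Π ] IsRefutation (PHP G) Π × size Π ≤ k × width Π ≡ d →
              ∃[ Π ] IsRefutation (PHP G) Π × size Π ≤ l × width Π ≡ d
    enlarge k≤l (Π , isRefutation , size≤ , width≡) =
      Π , isRefutation , ℕ.≤-trans size≤ k≤l , width≡

  -- For `d = 0` there are no edges, hence no variables, no inferences and no sink. An isolated
  -- pigeon makes the empty clause a hypothesis, so the surplus at its vertex is no longer
  -- guaranteed; that case is separated.
  refutation : 1 ≤ d → n < m → ∃[ Π ] IsRefutation (PHP G) Π × size Π ≤ 14 * N ^ 4 × width Π ≡ d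
  refutation 1≤d n<m = go (maxDegree-attained 1≤d) (Fin.any? empty?)
    where
    go : ∃[ es ] Unique es × length {A = Edge G} es ≡ d × d ≤ N → Dec (∃[ u ] incidentˡ G u ≡ []) →
         ∃[ Π ] IsRefutation (PHP G) Π × size Π ≤ 14 * N ^ 4 × width Π ≡ d
    go ([] , _ , 0≡d , _) _ = contradiction (subst (1 ≤_) (sym 0≡d) 1≤d) λ ()
    go (e ∷ es , es! , ∣es∣≡d , d≤N) (yes (u , isolated)) =
      enlarge
        (ℕ.≤-trans (ℕ.m≤m+n 7 7) (ℕ.*-monoʳ-≤ 14 (ℕ.^-monoˡ-≤ 4 (ℕ.≤-trans 1≤d d≤N))))
        (realize-trivial (subst (PHP G) (cong (map pos) isolated) (pigeon u)) 1≤d e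
          (map pos (e ∷ es)) (trans (∣map-pos∣ es!) ∣es∣≡d))
    go (e ∷ es , es! , ∣es∣≡d , d≤N) (no ¬isolated) =
      enlarge (size-bound d≤N (ℕ.≤-trans 1≤d d≤N))
        (realize matchingNet n<m (PHP-nonempty λ u isolated → ¬isolated (u , isolated))
          (map pos (e ∷ es)) (trans (∣map-pos∣ es!) ∣es∣≡d))

theorem5 : ∃[ c ] ∃[ k ]
    (∀ (m n d : ℕ) (G : BipartiteGraph m n) → maxDegree G ≡ d → 1 ≤ d → n < m →
    let open CircularResolution (_≟ᵉ_ G) in
    ∃[ Π ] IsRefutation (PHP G) Π × size Π ≤ c * (m + n) ^ k × width Π ≡ d)
theorem5 = 14 , 4 , λ m n d G maxDegree≡d → refutation G maxDegree≡d
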